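{- Let $\lambda\in\mathbb{R}$ and $r\in\mathbb{N}\cup\{0\}$. For every integer $n\ge0$, the following identities hold (as polynomials in the variable $x$): $$(x+r|\lambda)_n=\sum_{k=0}^{n}S_{2,r}(n+r,k+r|\lambda)\,(x)_k=\sum_{k=0}^{n}\lambda^{n-k}S_1(n,k)(x+r)^k.$$
   Context: All generating functions are formal power series in $t$. The degenerate factorials are $(y|\lambda)_0=1$ and $(y|\lambda)_n=y(y-\lambda)(y-2\lambda)\cdots(y-(n-1)\lambda)$ for $n\ge1$. For a number $y$, $(1+\lambda t)^{y/\lambda}$ denotes the formal power series $\sum_{n\ge0}(y|\lambda)_n\frac{t^n}{n!}$ (for $\lambda=0$ this is the limit $e^{yt}$). The convention $0^0=1$ is used. The falling factorials are $(x)_0=1$ and $(x)_n=x(x-1)\cdots(x-n+1)$ for $n\ge1$. The (signed) Stirling numbers of the first kind $S_1(n,k)$ are defined by $(x)_n=\sum_{k=0}^n S_1(n,k)x^k$. The extended degenerate Stirling numbers of the second kind $S_{2,r}(n+r,k+r|\lambda)$ are defined, for $r,k\in\mathbb{N}\cup\{0\}$, by $$\frac{1}{k!}(1+\lambda t)^{r/\lambda}\left((1+\lambda t)^{1/\lambda}-1\right)^k=\sum_{n=k}^\infty S_{2,r}(n+r,k+r|\lambda)\frac{t^n}{n!}.$$ -}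

module Defs where

open import Algebra.Bundles using (CommutativeRing; RawRing)
open import Data.Fin.Base using (toℕ)
open import Data.List.Base using (List; []; _∷_; map)
open import Data.Nat.Base using (ℕ; zero; suc; _∸_; _!; NonZero)
open import Data.Nat.Properties using (_!≢0)
open import Data.Product.Base using (proj₁)
open import Level using (Level; _⊔_)
import Algebra.Definitions as Definitions
import Algebra.Definitions.RawSemiring as RawSemiringDefinitions

-- The scalars.  The standard library has no real numbers, so instead of ℝ the
-- scalars range over all commutative rings in which every positive integer is
-- invertible; ℝ is such a ring, and the defining formulas below divide by
-- nothing but factorials.

record CommutativeℚAlgebra (c ℓ : Level) : Set (Level.suc (c ⊔ ℓ)) where
  field
    commutativeRing : CommutativeRing c ℓ

  open CommutativeRing commutativeRing public
  open RawRing rawRing public using (rawSemiring)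
  open RawSemiringDefinitions rawSemiring using (_×_)
  open Definitions _≈_ using (Invertible)

  field
    invertible : ∀ n → .{{_ : NonZero n}} → Invertible 1# _*_ (n × 1#)

  -- 1 / n!
  1/_! : ℕ → Carrier
  1/ n ! = proj₁ (invertible (n !) {{n !≢0}})

-- Used both for scalars and for polynomials.

module Factorials {c ℓ : Level} (R : RawRing c ℓ) where
  open RawRing R
  open RawSemiringDefinitions rawSemiring using (_×_; sum)

  -- degenerateFactorial y l n = y (y − l) (y − 2l) ⋯ (y − (n−1)l)
  degenerateFactorial : Carrier → Carrier → ℕ → Carrier
  degenerateFactorial y l zero    = 1#
  degenerateFactorial y l (suc n) = degenerateFactorial y l n * (y + - (n × l))

  fallingFactorial : Carrier → ℕ → Carrier
  fallingFactorial x zero    = 1#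
  fallingFactorial x (suc n) = fallingFactorial x n * (x + - (n × 1#))

  -- Both end points are included: f 0 + f 1 + ⋯ + f n.
  sum≤ : ℕ → (ℕ → Carrier) → Carrier
  sum≤ n f = sum {suc n} (λ k → f (toℕ k))

module Polynomials {c ℓ : Level} (R : RawRing c ℓ) where
  open RawRing R

  -- Coefficients are listed from the constant term upwards.  Trailing zeros are
  -- allowed, and equality is equality of all coefficients.
  Polynomial : Set c
  Polynomial = List Carrier

  coefficient : Polynomial → ℕ → Carrier
  coefficient []      k       = 0#
  coefficient (a ∷ p) zero    = a
  coefficient (a ∷ p) (suc k) = coefficient p k

  constant : Carrier → Polynomial
  constant a = a ∷ []

  X : Polynomial
  X = 0# ∷ 1# ∷ []

  addₚ : Polynomial → Polynomial → Polynomial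
  addₚ []      q       = q
  addₚ (a ∷ p) []      = a ∷ p
  addₚ (a ∷ p) (b ∷ q) = (a + b) ∷ addₚ p q

  mulₚ : Polynomial → Polynomial → Polynomial
  mulₚ []      q = []
  mulₚ (a ∷ p) q = addₚ (map (a *_) q) (0# ∷ mulₚ p q)

  polynomialRing : RawRing c ℓ
  polynomialRing = record
    { Carrier = Polynomial
    ; _≈_     = λ p q → ∀ k → coefficient p k ≈ coefficient q k
    ; _+_     = addₚ
    ; _*_     = mulₚ
    ; -_      = map -_
    ; 0#      = []
    ; 1#      = constant 1#
    }

module FormalPowerSeries {c ℓ : Level} (R : RawRing c ℓ) where
  open RawRing R
  open Factorials R using (sum≤)

  -- f n is the coefficient of tⁿ (not of tⁿ/n!).
  Series : Set c
  Series = ℕ → Carrier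

  scale : Carrier → Series → Series
  scale a f n = a * f n

  seriesRing : RawRing c ℓ
  seriesRing = record
    { Carrier = Series
    ; _≈_     = λ f g → ∀ n → f n ≈ g n
    ; _+_     = λ f g n → f n + g n
    ; _*_     = λ f g n → sum≤ n (λ i → f i * g (n ∸ i))
    ; -_      = λ f n → - f n
    ; 0#      = λ _ → 0#
    ; 1#      = λ { zero → 1# ; (suc _) → 0# }
    }

module Stirling {c ℓ : Level} (A : CommutativeℚAlgebra c ℓ) where
  open CommutativeℚAlgebra A using (Carrier; _*_; 1#; 1/_!; rawRing; rawSemiring)
  open RawSemiringDefinitions rawSemiring using (_×_)
  open Factorials rawRing using (degenerateFactorial)
  open FormalPowerSeries rawRing using (Series; scale; seriesRing)
  open Polynomials rawRing using (X; coefficient; polynomialRing)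

  private
    module S  = RawRing seriesRing
    module S′ = RawSemiringDefinitions S.rawSemiring
    module P  = Factorials polynomialRing

  -- degenerateExp l y = (1 + l t)^(y/l) = Σₙ (y|l)ₙ tⁿ/n!, also for l = 0.
  degenerateExp : Carrier → Carrier → Series
  degenerateExp l y n = degenerateFactorial y l n * 1/ n !

  -- (1/k!) (1 + l t)^(r/l) ((1 + l t)^(1/l) − 1)ᵏ
  S₂-series : Carrier → ℕ → ℕ → Series
  S₂-series l r k =
    scale (1/ k !)
      (degenerateExp l (r × 1#) S.* ((degenerateExp l 1# S.+ S.- S.1#) S′.^ k))

  -- S₂ l r n k is the number written S_{2,r}(n+r, k+r | l): the coefficient of
  -- tⁿ/n! in S₂-series l r k.  The arguments n and k are the unshifted indices.
  S₂ : Carrier → ℕ → ℕ → ℕ → Carrier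
  S₂ l r n k = ((n !) × 1#) * S₂-series l r k n

  -- The coefficient of xᵏ in (x)ₙ, taken among the scalars rather than in ℤ.
  S₁ : ℕ → ℕ → Carrier
  S₁ n k = coefficient (P.fallingFactorial X n) k

{-# OPTIONS --safe #-}
module Submission where

-- Both right-hand sides are built one factor at a time.  If s (n+1) k =
-- s n (k−1) + w n k · s n k and b k · (y − n l) = b (k+1) + w n k · b k, then
-- multiplying Σₖ s n k · b k by y − n l gives Σₖ s (n+1) k · b k.  With y = x + r,
-- the basis b k = (x)ₖ goes with w n k = r + k − n l, and b k = (x + r)ᵏ with
-- w n k = − n l.
-- The recurrence for S₂ comes from the derivation D = (1 + l t) d/dt of power
-- series: D (1 + l t)^(y/l) = y (1 + l t)^(y/l), so the generating function Fₖ
-- satisfies D Fₖ = Fₖ₋₁ + (r + k) Fₖ.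
-- The ring laws for polynomials are inherited from those for power series.

open import Defs
open import Algebra.Bundles using (CommutativeRing; RawRing)
import Algebra.Construct.Pointwise as Pointwise
import Algebra.Definitions.RawSemiring as RawSemiringDefinitions
import Algebra.Morphism.RingMonomorphism as RingMonomorphism
open import Algebra.Morphism.Structures using (IsRingHomomorphism; IsRingMonomorphism)
import Algebra.Properties.CommutativeMonoid.Mult as CommutativeMonoidMult
import Algebra.Properties.CommutativeSemigroup as CommutativeSemigroupProperties
import Algebra.Properties.Ring as RingProperties
import Algebra.Properties.Semiring.Mult as SemiringMult
import Algebra.Properties.Semiring.Sum as SemiringSum
import Algebra.Solver.Ring.NaturalCoefficients.Default as Solver
open import Data.Fin.Base using (toℕ)
open import Data.List.Base using ([]; _∷_; map)
open import Data.Nat.Base using (ℕ; zero; suc; _∸_; _!; _<_; s≤s; s<s)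
open import Data.Nat.Properties using (_!≢0; m<n⇒m<1+n; n<1+n; _<?_; ≮⇒≥; +-∸-assoc)
open import Data.Product.Base using (_×_; _,_; proj₁; proj₂)
open import Function.Base using (_∘_; id)
open import Relation.Binary.PropositionalEquality as ≡ using ()
import Relation.Binary.Reasoning.Setoid as ≈-Reasoning
open import Relation.Nullary.Decidable.Core using (yes; no)

-- Formal power series: the Cauchy product ring and its derivations.

module PowerSeries {c ℓ} (R : CommutativeRing c ℓ) where
  open CommutativeRing R
  open SemiringMult semiring using (×-congʳ; ×-comm-*)
    renaming (_×_ to _·_)
  open CommutativeMonoidMult +-commutativeMonoid using (×-distrib-+)
  open SemiringSum semiring
    using (sum-cong-≋; ∑-distrib-+; *-distribˡ-sum; sum-replicate-zero)
  open Solver commutativeSemiring using (solve; _:=_; _:+_; _:*_)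
  open FormalPowerSeries rawRing
  open ≈-Reasoning setoid

  private
    module S = RawRing seriesRing
  open S using () renaming (_≈_ to _≋_; _*_ to _⋆_; _+_ to _⊕_; 1# to 𝟙)
  open RawSemiringDefinitions S.rawSemiring using (_^_)

  shift : Series → Series
  shift f n = f (suc n)

  ⋆-cong : ∀ {f f′ g g′} → f ≋ f′ → g ≋ g′ → f ⋆ g ≋ f′ ⋆ g′
  ⋆-cong f≋f′ g≋g′ n =
    sum-cong-≋ {suc n} λ i → *-cong (f≋f′ (toℕ i)) (g≋g′ (n ∸ toℕ i))

  ⋆-congˡ : ∀ f {g g′} → g ≋ g′ → f ⋆ g ≋ f ⋆ g′
  ⋆-congˡ f = ⋆-cong {f} λ _ → refl

  ⋆-congʳ : ∀ g {f f′} → f ≋ f′ → f ⋆ g ≋ f′ ⋆ g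
  ⋆-congʳ g f≋f′ = ⋆-cong {g = g} f≋f′ λ _ → refl

  ⋆-distribˡ : ∀ f g h → f ⋆ (g ⊕ h) ≋ (f ⋆ g) ⊕ (f ⋆ h)
  ⋆-distribˡ f g h n =
    trans (sum-cong-≋ {suc n} λ i → distribˡ (f (toℕ i)) (g (n ∸ toℕ i)) (h (n ∸ toℕ i)))
      (∑-distrib-+ {suc n} (λ i → f (toℕ i) * g (n ∸ toℕ i)) (λ i → f (toℕ i) * h (n ∸ toℕ i)))

  scale-⋆ : ∀ a f g → scale a f ⋆ g ≋ scale a (f ⋆ g)
  scale-⋆ a f g n =
    trans (sum-cong-≋ {suc n} λ i → *-assoc a (f (toℕ i)) (g (n ∸ toℕ i)))
      (sym (*-distribˡ-sum {suc n} a λ i → f (toℕ i) * g (n ∸ toℕ i)))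

  ⋆-zeroˡ : ∀ g → S.0# ⋆ g ≋ S.0#
  ⋆-zeroˡ g n =
    trans (sum-cong-≋ {suc n} λ i → zeroˡ (g (n ∸ toℕ i))) (sum-replicate-zero (suc n))

  ⋆-zero-coefficient : ∀ f g → (f ⋆ g) 0 ≈ f 0 * g 0
  ⋆-zero-coefficient f g = +-identityʳ _

  -- By definition the Cauchy sum unfolds from the end that holds `f 0`; this splits it at the
  -- opposite end, so that `⋆-comm` becomes an induction on the index.
  ⋆-suc-coefficientʳ : ∀ f g n → (f ⋆ g) (suc n) ≈ (f ⋆ shift g) n + f (suc n) * g 0
  ⋆-suc-coefficientʳ f g zero    =
    trans (+-congˡ (+-identityʳ _)) (+-congʳ (sym (+-identityʳ _)))
  ⋆-suc-coefficientʳ f g (suc n) =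
    trans (+-congˡ (⋆-suc-coefficientʳ (shift f) g n)) (sym (+-assoc _ _ _))

  ⋆-comm : ∀ f g → f ⋆ g ≋ g ⋆ f
  ⋆-comm f g zero    = +-congʳ (*-comm _ _)
  ⋆-comm f g (suc n) = begin
    (f ⋆ g) (suc n)                    ≈⟨ ⋆-suc-coefficientʳ f g n ⟩
    (f ⋆ shift g) n + f (suc n) * g 0  ≈⟨ +-cong (⋆-comm f (shift g) n) (*-comm _ _) ⟩
    (shift g ⋆ f) n + g 0 * f (suc n)  ≈⟨ +-comm _ _ ⟩
    (g ⋆ f) (suc n)                    ∎

  ⋆-distribʳ : ∀ f g h → (g ⊕ h) ⋆ f ≋ (g ⋆ f) ⊕ (h ⋆ f)
  ⋆-distribʳ f g h n = begin
    ((g ⊕ h) ⋆ f) n        ≈⟨ ⋆-comm (g ⊕ h) f n ⟩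
    (f ⋆ (g ⊕ h)) n        ≈⟨ ⋆-distribˡ f g h n ⟩
    (f ⋆ g) n + (f ⋆ h) n  ≈⟨ +-cong (⋆-comm f g n) (⋆-comm f h n) ⟩
    (g ⋆ f) n + (h ⋆ f) n  ∎

  ⋆-scale : ∀ a f g → f ⋆ scale a g ≋ scale a (f ⋆ g)
  ⋆-scale a f g n = begin
    (f ⋆ scale a g) n  ≈⟨ ⋆-comm f (scale a g) n ⟩
    (scale a g ⋆ f) n  ≈⟨ scale-⋆ a g f n ⟩
    a * (g ⋆ f) n      ≈⟨ *-congˡ (⋆-comm g f n) ⟩
    a * (f ⋆ g) n      ∎

  ⋆-identityˡ : ∀ f → 𝟙 ⋆ f ≋ f
  ⋆-identityˡ f zero    = trans (+-identityʳ _) (*-identityˡ _)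
  ⋆-identityˡ f (suc n) =
    trans (+-cong (*-identityˡ _) (⋆-zeroˡ f n)) (+-identityʳ _)

  ⋆-identityʳ : ∀ f → f ⋆ 𝟙 ≋ f
  ⋆-identityʳ f n = trans (⋆-comm f 𝟙 n) (⋆-identityˡ f n)

  ⋆-assoc : ∀ f g h → (f ⋆ g) ⋆ h ≋ f ⋆ (g ⋆ h)
  ⋆-assoc f g h zero    = +-congʳ (begin
    (f ⋆ g) 0 * h 0    ≈⟨ *-congʳ (⋆-zero-coefficient f g) ⟩
    f 0 * g 0 * h 0    ≈⟨ *-assoc _ _ _ ⟩
    f 0 * (g 0 * h 0)  ≈⟨ *-congˡ (⋆-zero-coefficient g h) ⟨
    f 0 * (g ⋆ h) 0    ∎)
  ⋆-assoc f g h (suc n) = begin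
    (f ⋆ g) 0 * h (suc n) + (shift (f ⋆ g) ⋆ h) n
      -- `shift (f ⋆ g)` unfolds to `scale (f 0) (shift g) ⊕ (shift f ⋆ g)`; the induction
      -- hypothesis then applies to the tail `shift f`.
      ≈⟨ +-cong (*-congʳ (⋆-zero-coefficient f g)) (⋆-distribʳ h (scale (f 0) (shift g)) (shift f ⋆ g) n) ⟩
    f 0 * g 0 * h (suc n) + ((scale (f 0) (shift g) ⋆ h) n + ((shift f ⋆ g) ⋆ h) n)
      ≈⟨ +-cong (*-assoc _ _ _) (+-cong (scale-⋆ (f 0) (shift g) h n) (⋆-assoc (shift f) g h n)) ⟩
    f 0 * (g 0 * h (suc n)) + (f 0 * (shift g ⋆ h) n + (shift f ⋆ (g ⋆ h)) n)
      ≈⟨ +-assoc _ _ _ ⟨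
    f 0 * (g 0 * h (suc n)) + f 0 * (shift g ⋆ h) n + (shift f ⋆ (g ⋆ h)) n
      ≈⟨ +-congʳ (distribˡ _ _ _) ⟨
    (f ⋆ (g ⋆ h)) (suc n) ∎

  seriesCommutativeRing : CommutativeRing c ℓ
  seriesCommutativeRing = record
    { isCommutativeRing = record
      { isRing = record
        { +-isAbelianGroup = Pointwise.isAbelianGroup ℕ +-isAbelianGroup
        ; *-cong           = ⋆-cong
        ; *-assoc          = ⋆-assoc
        ; *-identity       = ⋆-identityˡ , ⋆-identityʳ
        ; distrib          = ⋆-distribˡ , ⋆-distribʳ
        }
      ; *-comm = ⋆-comm
      }
    }

  -- t d/dt
  euler : Series → Series
  euler f n = n · f n

  -- `euler` weights each coefficient by its degree, and degrees add in a product. The induction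
  -- peels off the term with `f 0`, whose whole weight falls on `g`.
  euler-⋆ : ∀ f g → euler (f ⋆ g) ≋ (euler f ⋆ g) ⊕ (f ⋆ euler g)
  euler-⋆ f g zero    = sym (begin
    (0# * g 0 + 0#) + (f 0 * 0# + 0#)  ≈⟨ +-cong (+-identityʳ _) (+-identityʳ _) ⟩
    0# * g 0 + f 0 * 0#                ≈⟨ +-cong (zeroˡ _) (zeroʳ _) ⟩
    0# + 0#                            ≈⟨ +-identityʳ _ ⟩
    0#                                 ∎)
  euler-⋆ f g (suc n) = begin
    (f ⋆ g) (suc n) + n · (f ⋆ g) (suc n)
      ≈⟨ +-congˡ (×-distrib-+ _ _ n) ⟩
    (p + q) + (n · p + n · q)
      ≈⟨ +-congˡ (+-congˡ (euler-⋆ (shift f) g n)) ⟩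
    (p + q) + (n · p + (u + v))
      ≈⟨ solve 5 (λ p q np u v →
           (p :+ q) :+ (np :+ (u :+ v)) := (q :+ u) :+ ((p :+ np) :+ v)) refl
           p q (n · p) u v ⟩
    (q + u) + ((p + n · p) + v)
      ≈⟨ +-cong lemma₁ (+-congʳ (×-comm-* (suc n) (f 0) (g (suc n)))) ⟨
    (euler f ⋆ g) (suc n) + (f ⋆ euler g) (suc n) ∎
    where
    p = f 0 * g (suc n)
    q = (shift f ⋆ g) n
    u = (euler (shift f) ⋆ g) n
    v = (shift f ⋆ euler g) n
    lemma₁ : (euler f ⋆ g) (suc n) ≈ q + u
    lemma₁ = begin
      0# * g (suc n) + (shift (euler f) ⋆ g) n  ≈⟨ +-congʳ (zeroˡ _) ⟩
      0# + (shift (euler f) ⋆ g) n              ≈⟨ +-identityˡ _ ⟩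
      -- `suc n · a` unfolds to `a + n · a`, so `shift (euler f)` is `shift f ⊕ euler (shift f)`.
      (shift (euler f) ⋆ g) n                   ≈⟨ ⋆-distribʳ g (shift f) (euler (shift f)) n ⟩
      q + u                                     ∎

  -- (1 + l t) d/dt
  derivation : Carrier → Series → Series
  derivation l f = shift (euler f) ⊕ scale l (euler f)

  derivation-cong : ∀ l {f g} → f ≋ g → derivation l f ≋ derivation l g
  derivation-cong l f≋g n =
    +-cong (×-congʳ (suc n) (f≋g (suc n))) (*-congˡ (×-congʳ n (f≋g n)))

  derivation-scale : ∀ l a f → derivation l (scale a f) ≋ scale a (derivation l f)
  derivation-scale l a f n = begin
    suc n · (a * f (suc n)) + l * (n · (a * f n))
      ≈⟨ +-cong (×-comm-* (suc n) a _) (*-congˡ (×-comm-* n a _)) ⟨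
    a * p + l * (a * q)
      ≈⟨ solve 4 (λ a l p q → a :* p :+ l :* (a :* q) := a :* (p :+ l :* q)) refl a l p q ⟩
    a * (p + l * q) ∎
    where
    p = suc n · f (suc n)
    q = n · f n

  -- This is `euler-⋆` at the indices n+1 and n. Since `euler` kills constant terms, the shift
  -- passes onto either factor without a boundary term (`left`, `right`).
  derivation-⋆ : ∀ l f g → derivation l (f ⋆ g) ≋ (derivation l f ⋆ g) ⊕ (f ⋆ derivation l g)
  derivation-⋆ l f g n = begin
    euler (f ⋆ g) (suc n) + l * euler (f ⋆ g) n
      ≈⟨ +-cong (euler-⋆ f g (suc n)) (*-congˡ (euler-⋆ f g n)) ⟩
    ((euler f ⋆ g) (suc n) + (f ⋆ euler g) (suc n)) + l * (u + v)
      ≈⟨ +-congʳ (+-cong left right) ⟩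
    (p + q) + l * (u + v)
      ≈⟨ solve 5 (λ l p q u v →
           (p :+ q) :+ l :* (u :+ v) := (p :+ l :* u) :+ (q :+ l :* v)) refl l p q u v ⟩
    (p + l * u) + (q + l * v)
      ≈⟨ +-cong (+-congˡ (scale-⋆ l (euler f) g n)) (+-congˡ (⋆-scale l f (euler g) n)) ⟨
    (p + (scale l (euler f) ⋆ g) n) + (q + (f ⋆ scale l (euler g)) n)
      ≈⟨ +-cong (⋆-distribʳ g (shift (euler f)) (scale l (euler f)) n)
                (⋆-distribˡ f (shift (euler g)) (scale l (euler g)) n) ⟨
    (derivation l f ⋆ g) n + (f ⋆ derivation l g) n ∎
    where
    p = (shift (euler f) ⋆ g) n
    q = (f ⋆ shift (euler g)) n
    u = (euler f ⋆ g) n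
    v = (f ⋆ euler g) n
    left : (euler f ⋆ g) (suc n) ≈ p
    left = trans (+-congʳ (zeroˡ _)) (+-identityˡ _)
    right : (f ⋆ euler g) (suc n) ≈ q
    right = trans (⋆-suc-coefficientʳ f (euler g) n)
              (trans (+-congˡ (zeroʳ _)) (+-identityʳ _))

  derivation-^ : ∀ l g k →
    derivation l (g ^ suc k) ≋ scale (suc k · 1#) ((g ^ k) ⋆ derivation l g)
  derivation-^ l g zero n = begin
    derivation l (g ⋆ 𝟙) n             ≈⟨ derivation-cong l (⋆-identityʳ g) n ⟩
    derivation l g n                   ≈⟨ ⋆-identityˡ (derivation l g) n ⟨
    (𝟙 ⋆ derivation l g) n             ≈⟨ *-identityˡ _ ⟨
    1# * (𝟙 ⋆ derivation l g) n        ≈⟨ *-congʳ (+-identityʳ 1#) ⟨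
    (1# + 0#) * (𝟙 ⋆ derivation l g) n ∎
  derivation-^ l g (suc k) n = begin
    derivation l (g ⋆ h) n
      ≈⟨ derivation-⋆ l g h n ⟩
    (g′ ⋆ h) n + (g ⋆ derivation l h) n
      ≈⟨ +-cong (⋆-comm g′ h n) (⋆-congˡ g (derivation-^ l g k) n) ⟩
    (h ⋆ g′) n + (g ⋆ scale (suc k · 1#) ((g ^ k) ⋆ g′)) n
      ≈⟨ +-congˡ (⋆-scale (suc k · 1#) g ((g ^ k) ⋆ g′) n) ⟩
    (h ⋆ g′) n + (suc k · 1#) * (g ⋆ ((g ^ k) ⋆ g′)) n
      ≈⟨ +-cong (*-identityˡ _) (*-congˡ (⋆-assoc g (g ^ k) g′ n)) ⟨
    1# * (h ⋆ g′) n + (suc k · 1#) * (h ⋆ g′) n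
      ≈⟨ distribʳ _ _ _ ⟨
    (suc (suc k) · 1#) * (h ⋆ g′) n ∎
    where
    g′ = derivation l g
    h = g ^ suc k

-- Recurrence for the extended degenerate Stirling numbers of the second kind.

module Stirling₂Recurrence {c ℓ} (A : CommutativeℚAlgebra c ℓ) where
  open CommutativeℚAlgebra A
  open RingProperties ring using (-0#≈0#; -‿distribˡ-*)
  open SemiringMult semiring using (×-congʳ; ×-comm-*; ×-assoc-*; ×1-homo-*)
    renaming (_×_ to _·_)
  open Solver commutativeSemiring using (solve; _:=_; _:+_; _:*_)
  open Factorials rawRing
  open FormalPowerSeries rawRing
  open PowerSeries commutativeRing
  open Stirling A
  open ≈-Reasoning setoid
  private
    module S = RawRing seriesRing
  open S using () renaming (_≈_ to _≋_; _*_ to _⋆_; _+_ to _⊕_; 1# to 𝟙)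
  open RawSemiringDefinitions S.rawSemiring using (_^_)

  !-inverseʳ : ∀ n → ((n !) · 1#) * 1/ n ! ≈ 1#
  !-inverseʳ n = proj₂ (proj₂ (invertible (n !) {{n !≢0}}))

  1/0!≈1 : 1/ 0 ! ≈ 1#
  1/0!≈1 = begin
    1/ 0 !                ≈⟨ *-identityˡ _ ⟨
    1# * 1/ 0 !           ≈⟨ *-congʳ (+-identityʳ 1#) ⟨
    ((0 !) · 1#) * 1/ 0 !   ≈⟨ !-inverseʳ 0 ⟩
    1#                    ∎

  -- Each reciprocal comes from its own invertibility witness, so consecutive ones have to be
  -- related: insert 1 as n! times `1/ n !` and merge (n+1) · n! into (n+1)!.
  [1+n]*1/[1+n]! : ∀ n → (suc n · 1#) * 1/ (suc n) ! ≈ 1/ n !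
  [1+n]*1/[1+n]! n = begin
    s * i′              ≈⟨ *-identityʳ _ ⟨
    s * i′ * 1#         ≈⟨ *-congˡ (!-inverseʳ n) ⟨
    s * i′ * (a * i)    ≈⟨ solve 4 (λ s i′ a i → s :* i′ :* (a :* i) := s :* a :* i′ :* i) refl s i′ a i ⟩
    s * a * i′ * i      ≈⟨ *-congʳ (*-congʳ (×1-homo-* (suc n) (n !))) ⟨
    ((suc n !) · 1#) * i′ * i  ≈⟨ *-congʳ (!-inverseʳ (suc n)) ⟩
    1# * i              ≈⟨ *-identityˡ _ ⟩
    i                   ∎
    where
    s = suc n · 1#
    a = (n !) · 1#
    i = 1/ n !
    i′ = 1/ (suc n) !

  ·-1-* : ∀ n x → n · x ≈ (n · 1#) * x
  ·-1-* n x = sym (trans (×-assoc-* n 1# x) (×-congʳ n (*-identityˡ x)))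

  -- The term -n l in the last factor of (y|l)ₙ₊₁ cancels against the n l contributed by l t d/dt,
  -- leaving y. No division by l occurs, so l = 0 is covered.
  derivation-degenerateExp : ∀ l y → derivation l (degenerateExp l y) ≋ scale y (degenerateExp l y)
  derivation-degenerateExp l y n = begin
    suc n · (d * (y - n · l) * 1/ (suc n) !) + l * (n · (d * i))
      ≈⟨ +-cong (×-comm-* (suc n) _ _) (trans (×-assoc-* n l _) (sym (×-comm-* n l _))) ⟨
    d * (y - n · l) * (suc n · 1/ (suc n) !) + (n · l) * (d * i)
      ≈⟨ +-congʳ (*-congˡ (trans (·-1-* (suc n) _) ([1+n]*1/[1+n]! n))) ⟩
    d * (y - n · l) * i + (n · l) * (d * i)
      ≈⟨ solve 5 (λ d y m m′ i → d :* (y :+ m′) :* i :+ m :* (d :* i) := (y :+ (m′ :+ m)) :* (d :* i)) refl d y (n · l) (- (n · l)) i ⟩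
    (y + (- (n · l) + n · l)) * (d * i)
      ≈⟨ *-congʳ (trans (+-congˡ (-‿inverseˡ _)) (+-identityʳ y)) ⟩
    y * (d * i) ∎
    where
    d = degenerateFactorial y l n
    i = 1/ n !

  degenerateExp-0 : ∀ l y → degenerateExp l y 0 ≈ 1#
  degenerateExp-0 l y = trans (*-identityˡ _) 1/0!≈1

  egf-coefficient : Series → ℕ → Carrier
  egf-coefficient f n = ((n !) · 1#) * f n

  -- Turns an identity for `derivation l f` into a recurrence in n: d/dt alone moves the coefficient
  -- of tⁿ/n! one place down, and the l t d/dt part is compensated by the term with -n l.
  egf-coefficient-suc : ∀ l f n →
    egf-coefficient f (suc n) ≈ ((n !) · 1#) * derivation l f n + - (n · l) * egf-coefficient f n
  egf-coefficient-suc l f n = begin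
    ((suc n !) · 1#) * f (suc n)
      ≈⟨ *-congʳ (trans (×1-homo-* (suc n) (n !)) (*-comm _ _)) ⟩
    a * (suc n · 1#) * f (suc n)
      ≈⟨ trans (*-assoc _ _ _) (*-congˡ (sym (·-1-* (suc n) _))) ⟩
    a * p
      -- Adding `(m - m) * f n` completes `p` to the coefficient of `derivation l f`.
      ≈⟨ *-congˡ (trans (+-congˡ (trans (*-congʳ (-‿inverseʳ m)) (zeroˡ _))) (+-identityʳ p)) ⟨
    a * (p + (m - m) * f n)
      ≈⟨ solve 5 (λ a p m m′ x → a :* (p :+ (m :+ m′) :* x) := a :* (p :+ m :* x) :+ m′ :* (a :* x))
           refl a p m (- m) (f n) ⟩
    a * (p + m * f n) + - m * (a * f n)
      ≈⟨ +-congʳ (*-congˡ (+-congˡ (trans (×-assoc-* n l _) (sym (×-comm-* n l _))))) ⟩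
    a * derivation l f n + - m * (a * f n) ∎
    where
    a = (n !) · 1#
    m = n · l
    p = suc n · f (suc n)

  expMinusOne : Carrier → Series
  expMinusOne l = degenerateExp l 1# ⊕ S.- 𝟙

  expMinusOne-⊕-1 : ∀ l → expMinusOne l ⊕ 𝟙 ≋ degenerateExp l 1#
  expMinusOne-⊕-1 l n = trans (+-assoc _ _ _) (trans (+-congˡ (-‿inverseˡ _)) (+-identityʳ _))

  expMinusOne-0 : ∀ l → expMinusOne l 0 ≈ 0#
  expMinusOne-0 l = trans (+-congʳ (degenerateExp-0 l 1#)) (-‿inverseʳ 1#)

  euler-expMinusOne : ∀ l → euler (expMinusOne l) ≋ euler (degenerateExp l 1#)
  euler-expMinusOne l zero    = refl
  euler-expMinusOne l (suc n) = ×-congʳ (suc n) (trans (+-congˡ -0#≈0#) (+-identityʳ _))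

  -- A derivation ignores the constant -1, so this is the differential equation of (1 + l t)^(1/l).
  -- In the power rule the summand `𝟙` produces the term of index one lower.
  derivation-expMinusOne : ∀ l → derivation l (expMinusOne l) ≋ expMinusOne l ⊕ 𝟙
  derivation-expMinusOne l n = begin
    derivation l (expMinusOne l) n               ≈⟨ +-cong (euler-expMinusOne l (suc n)) (*-congˡ (euler-expMinusOne l n)) ⟩
    derivation l (degenerateExp l 1#) n  ≈⟨ derivation-degenerateExp l 1# n ⟩
    1# * degenerateExp l 1# n            ≈⟨ *-identityˡ _ ⟩
    degenerateExp l 1# n                 ≈⟨ expMinusOne-⊕-1 l n ⟨
    expMinusOne l n + 𝟙 n                        ∎

  derivation-S₂-series-0 : ∀ l r →
    derivation l (S₂-series l r 0) ≋ scale (r · 1#) (S₂-series l r 0)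
  derivation-S₂-series-0 l r n = begin
    derivation l (S₂-series l r 0) n  ≈⟨ derivation-scale l i (e ⋆ 𝟙) n ⟩
    i * derivation l (e ⋆ 𝟙) n        ≈⟨ *-congˡ (derivation-cong l (⋆-identityʳ e) n) ⟩
    i * derivation l e n              ≈⟨ *-congˡ (derivation-degenerateExp l y n) ⟩
    i * (y * e n)                     ≈⟨ solve 3 (λ i y x → i :* (y :* x) := y :* (i :* x)) refl i y (e n) ⟩
    y * (i * e n)                     ≈⟨ *-congˡ (*-congˡ (⋆-identityʳ e n)) ⟨
    y * S₂-series l r 0 n             ∎
    where
    i = 1/ 0 !
    y = r · 1#
    e = degenerateExp l y

  -- Write e for (1 + l t)^(r/l) and g for `expMinusOne l`. The product rule combines D e = r e with
  -- D gᵏ⁺¹ = (k+1)(gᵏ + gᵏ⁺¹); on the gᵏ part the factor k+1 reduces 1/(k+1)! to 1/k!.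
  derivation-S₂-series-suc : ∀ l r k →
    derivation l (S₂-series l r (suc k)) ≋
    S₂-series l r k ⊕ scale (r · 1# + suc k · 1#) (S₂-series l r (suc k))
  derivation-S₂-series-suc l r k n = begin
    derivation l (S₂-series l r (suc k)) n
      ≈⟨ derivation-scale l i′ (e ⋆ (g ^ suc k)) n ⟩
    i′ * derivation l (e ⋆ (g ^ suc k)) n
      ≈⟨ *-congˡ (derivation-⋆ l e (g ^ suc k) n) ⟩
    i′ * ((derivation l e ⋆ (g ^ suc k)) n + (e ⋆ derivation l (g ^ suc k)) n)
      ≈⟨ *-congˡ (+-cong left right) ⟩
    i′ * (y * h′ + s * (h + h′))
      ≈⟨ solve 5 (λ i′ y s h h′ →
           i′ :* (y :* h′ :+ s :* (h :+ h′)) := s :* i′ :* h :+ (y :+ s) :* (i′ :* h′))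
           refl i′ y s h h′ ⟩
    s * i′ * h + (y + s) * (i′ * h′)
      ≈⟨ +-congʳ (*-congʳ ([1+n]*1/[1+n]! k)) ⟩
    1/ k ! * h + (y + s) * (i′ * h′) ∎
    where
    i′ = 1/ (suc k) !
    s = suc k · 1#
    y = r · 1#
    e = degenerateExp l y
    g = expMinusOne l
    h = (e ⋆ (g ^ k)) n
    h′ = (e ⋆ (g ^ suc k)) n
    left : (derivation l e ⋆ (g ^ suc k)) n ≈ y * h′
    left = trans (⋆-congʳ (g ^ suc k) (derivation-degenerateExp l y) n) (scale-⋆ y e (g ^ suc k) n)
    derivation-power : derivation l (g ^ suc k) ≋ scale s ((g ^ k) ⊕ (g ^ suc k))
    derivation-power m = trans (derivation-^ l g k m) (*-congˡ (begin
      ((g ^ k) ⋆ derivation l g) m         ≈⟨ ⋆-congˡ (g ^ k) (derivation-expMinusOne l) m ⟩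
      ((g ^ k) ⋆ (g ⊕ 𝟙)) m                ≈⟨ ⋆-distribˡ (g ^ k) g 𝟙 m ⟩
      ((g ^ k) ⋆ g) m + ((g ^ k) ⋆ 𝟙) m    ≈⟨ +-cong (⋆-comm (g ^ k) g m) (⋆-identityʳ (g ^ k) m) ⟩
      (g ^ suc k) m + (g ^ k) m            ≈⟨ +-comm _ _ ⟩
      (g ^ k) m + (g ^ suc k) m            ∎))
    right : (e ⋆ derivation l (g ^ suc k)) n ≈ s * (h + h′)
    right = begin
      (e ⋆ derivation l (g ^ suc k)) n              ≈⟨ ⋆-congˡ e derivation-power n ⟩
      (e ⋆ scale s ((g ^ k) ⊕ (g ^ suc k))) n       ≈⟨ ⋆-scale s e ((g ^ k) ⊕ (g ^ suc k)) n ⟩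
      s * (e ⋆ ((g ^ k) ⊕ (g ^ suc k))) n           ≈⟨ *-congˡ (⋆-distribˡ e (g ^ k) (g ^ suc k) n) ⟩
      s * (h + h′)                                  ∎

  S₂-0-0 : ∀ l r → S₂ l r 0 0 ≈ 1#
  S₂-0-0 l r = begin
    ((0 !) · 1#) * (1/ 0 ! * (e ⋆ 𝟙) 0)  ≈⟨ *-assoc _ _ _ ⟨
    ((0 !) · 1#) * 1/ 0 ! * (e ⋆ 𝟙) 0    ≈⟨ *-cong (!-inverseʳ 0) (⋆-identityʳ e 0) ⟩
    1# * e 0                           ≈⟨ *-identityˡ _ ⟩
    e 0                                ≈⟨ degenerateExp-0 l (r · 1#) ⟩
    1#                                 ∎
    where
    e = degenerateExp l (r · 1#)

  S₂-0-suc : ∀ l r k → S₂ l r 0 (suc k) ≈ 0#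
  S₂-0-suc l r k = trans (*-congˡ (trans (*-congˡ product≈0) (zeroʳ _))) (zeroʳ _)
    where
    e = degenerateExp l (r · 1#)
    g = expMinusOne l
    product≈0 : (e ⋆ (g ^ suc k)) 0 ≈ 0#
    product≈0 = begin
      (e ⋆ (g ^ suc k)) 0      ≈⟨ ⋆-zero-coefficient e (g ^ suc k) ⟩
      e 0 * (g ^ suc k) 0      ≈⟨ *-congˡ (⋆-zero-coefficient g (g ^ k)) ⟩
      -- The base of the power has constant term 0.
      e 0 * (g 0 * (g ^ k) 0)  ≈⟨ *-congˡ (trans (*-congʳ (expMinusOne-0 l)) (zeroˡ _)) ⟩
      e 0 * 0#                 ≈⟨ zeroʳ _ ⟩
      0#                       ∎

  S₂-suc-0 : ∀ l r n →
    S₂ l r (suc n) 0 ≈ (r · 1# + 0 · 1# + - (n · l)) * S₂ l r n 0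
  S₂-suc-0 l r n = begin
    S₂ l r (suc n) 0
      ≈⟨ egf-coefficient-suc l (S₂-series l r 0) n ⟩
    a * derivation l (S₂-series l r 0) n + - (n · l) * S₂ l r n 0
      ≈⟨ +-congʳ (*-congˡ (derivation-S₂-series-0 l r n)) ⟩
    a * ((r · 1#) * x) + - (n · l) * (a * x)
      ≈⟨ solve 4 (λ a y m x → a :* (y :* x) :+ m :* (a :* x) := (y :+ m) :* (a :* x))
           refl a (r · 1#) (- (n · l)) x ⟩
    (r · 1# + - (n · l)) * (a * x)
      -- The summand `0 · 1#` gives the weight the form r + k - n l also at k = 0.
      ≈⟨ *-congʳ (+-congʳ (+-identityʳ _)) ⟨
    (r · 1# + 0 · 1# + - (n · l)) * (a * x) ∎
    where
    a = (n !) · 1#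
    x = S₂-series l r 0 n

  S₂-suc-suc : ∀ l r n k →
    S₂ l r (suc n) (suc k) ≈ S₂ l r n k + (r · 1# + suc k · 1# + - (n · l)) * S₂ l r n (suc k)
  S₂-suc-suc l r n k = begin
    S₂ l r (suc n) (suc k)
      ≈⟨ egf-coefficient-suc l (S₂-series l r (suc k)) n ⟩
    a * derivation l (S₂-series l r (suc k)) n + - (n · l) * S₂ l r n (suc k)
      ≈⟨ +-congʳ (*-congˡ (derivation-S₂-series-suc l r k n)) ⟩
    a * (x + (r · 1# + suc k · 1#) * x′) + - (n · l) * (a * x′)
      ≈⟨ solve 5 (λ a y m x x′ →
           a :* (x :+ y :* x′) :+ m :* (a :* x′) := a :* x :+ (y :+ m) :* (a :* x′))
           refl a (r · 1# + suc k · 1#) (- (n · l)) x x′ ⟩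
    a * x + (r · 1# + suc k · 1# + - (n · l)) * (a * x′) ∎
    where
    a = (n !) · 1#
    x = S₂-series l r k n
    x′ = S₂-series l r (suc k) n

  -- Induction along the recurrence, starting from the vanishing constant terms at n = 0. It ends
  -- the expansion at k = n.
  S₂-vanishes : ∀ l r {n k} → n < k → S₂ l r n k ≈ 0#
  S₂-vanishes l r {zero}  {suc k} _         = S₂-0-suc l r k
  S₂-vanishes l r {suc n} {suc k} (s<s n<k) = begin
    S₂ l r (suc n) (suc k)                                   ≈⟨ S₂-suc-suc l r n k ⟩
    S₂ l r n k + (r · 1# + suc k · 1# + - (n · l)) * S₂ l r n (suc k)
      ≈⟨ +-cong (S₂-vanishes l r n<k) (*-congˡ (S₂-vanishes l r (m<n⇒m<1+n n<k))) ⟩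
    0# + (r · 1# + suc k · 1# + - (n · l)) * 0#
      ≈⟨ trans (+-identityˡ _) (zeroʳ _) ⟩
    0# ∎

-- Polynomials as a subring of the power series.

module PolynomialRing {c ℓ} (R : CommutativeRing c ℓ) where
  open CommutativeRing R
  open RingProperties ring using (-0#≈0#)
  open FormalPowerSeries rawRing using (seriesRing)
  open PowerSeries R
  open Polynomials rawRing
  open ≈-Reasoning setoid
  private
    module P = RawRing polynomialRing
    module S = RawRing seriesRing

  coefficient-+ : ∀ p q k → coefficient (p P.+ q) k ≈ coefficient p k + coefficient q k
  coefficient-+ []      q       k       = sym (+-identityˡ _)
  coefficient-+ (a ∷ p) []      k       = sym (+-identityʳ _)
  coefficient-+ (a ∷ p) (b ∷ q) zero    = refl
  coefficient-+ (a ∷ p) (b ∷ q) (suc k) = coefficient-+ p q k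

  coefficient-map-* : ∀ a p k → coefficient (map (a *_) p) k ≈ a * coefficient p k
  coefficient-map-* a []      k       = sym (zeroʳ a)
  coefficient-map-* a (b ∷ p) zero    = refl
  coefficient-map-* a (b ∷ p) (suc k) = coefficient-map-* a p k

  coefficient-neg : ∀ p k → coefficient (P.- p) k ≈ - coefficient p k
  coefficient-neg []      k       = sym -0#≈0#
  coefficient-neg (a ∷ p) zero    = refl
  coefficient-neg (a ∷ p) (suc k) = coefficient-neg p k

  coefficient-∷-* : ∀ a p q k →
    coefficient ((a ∷ p) P.* q) k ≈ a * coefficient q k + coefficient (0# ∷ p P.* q) k
  coefficient-∷-* a p q k =
    trans (coefficient-+ (map (a *_) q) (0# ∷ p P.* q) k) (+-congʳ (coefficient-map-* a q k))

  -- The recursion of `mulₚ` on its first factor is the unfolding of the Cauchy sum at its first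
  -- term.
  coefficient-* : ∀ p q k → coefficient (p P.* q) k ≈ (coefficient p S.* coefficient q) k
  coefficient-* []      q k       = sym (⋆-zeroˡ (coefficient q) k)
  coefficient-* (a ∷ p) q zero    = coefficient-∷-* a p q 0
  coefficient-* (a ∷ p) q (suc k) =
    trans (coefficient-∷-* a p q (suc k)) (+-congˡ (coefficient-* p q k))

  -- Equality of polynomials is by definition equality of their coefficient series, so congruence
  -- and injectivity are both `id`.
  coefficient-isRingMonomorphism : IsRingMonomorphism polynomialRing seriesRing coefficient
  coefficient-isRingMonomorphism = record
    { isRingHomomorphism = record
      { isSemiringHomomorphism = record
        { isNearSemiringHomomorphism = record
          { +-isMonoidHomomorphism = record
            { isMagmaHomomorphism = record
              { isRelHomomorphism = record { cong = id }
              ; homo              = coefficient-+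
              }
            ; ε-homo = λ _ → refl
            }
          ; *-homo = coefficient-*
          }
        ; 1#-homo = λ { zero → refl ; (suc _) → refl }
        }
      ; -‿homo = coefficient-neg
      }
    ; injective = id
    }

  polynomialCommutativeRing : CommutativeRing c ℓ
  polynomialCommutativeRing = record
    { isCommutativeRing = RingMonomorphism.isCommutativeRing coefficient-isRingMonomorphism
        (CommutativeRing.isCommutativeRing seriesCommutativeRing)
    }

  constant-cong : ∀ {a b} → a ≈ b → constant a P.≈ constant b
  constant-cong a≈b zero    = a≈b
  constant-cong a≈b (suc k) = refl

  constant-0 : constant 0# P.≈ P.0#
  constant-0 zero    = refl
  constant-0 (suc k) = refl

  constant-* : ∀ a b → constant (a * b) P.≈ constant a P.* constant b
  constant-* a b zero    = sym (+-identityʳ _)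
  constant-* a b (suc k) = refl

  -- Carries the scalar recurrences of the Stirling numbers over to polynomial coefficients of the
  -- expansions.
  constant-isRingHomomorphism : IsRingHomomorphism rawRing polynomialRing constant
  constant-isRingHomomorphism = record
    { isSemiringHomomorphism = record
      { isNearSemiringHomomorphism = record
        { +-isMonoidHomomorphism = record
          { isMagmaHomomorphism = record
            { isRelHomomorphism = record { cong = constant-cong }
            ; homo              = λ { a b zero → refl ; a b (suc _) → refl }
            }
          ; ε-homo = constant-0
          }
        ; *-homo = constant-*
        }
      ; 1#-homo = λ _ → refl
      }
    ; -‿homo = λ { a zero → refl ; a (suc _) → refl }
    }

  coefficient-constant-* : ∀ a p k → coefficient (constant a P.* p) k ≈ a * coefficient p k
  coefficient-constant-* a p k =
    trans (coefficient-∷-* a [] p k) (trans (+-congˡ (constant-0 k)) (+-identityʳ _))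

  coefficient-X-*-0 : ∀ p → coefficient (X P.* p) 0 ≈ 0#
  coefficient-X-*-0 p =
    trans (coefficient-∷-* 0# (P.1#) p 0) (trans (+-identityʳ _) (zeroˡ _))

  coefficient-X-*-suc : ∀ p k → coefficient (X P.* p) (suc k) ≈ coefficient p k
  coefficient-X-*-suc p k = begin
    -- `X` is `0# ∷ P.1#`: after one shift the remaining factor is 1.
    coefficient (X P.* p) (suc k)                              ≈⟨ coefficient-∷-* 0# P.1# p (suc k) ⟩
    0# * coefficient p (suc k) + coefficient (P.1# P.* p) k    ≈⟨ trans (+-congʳ (zeroˡ _)) (+-identityˡ _) ⟩
    coefficient (P.1# P.* p) k                                 ≈⟨ coefficient-constant-* 1# p k ⟩
    1# * coefficient p k                                       ≈⟨ *-identityˡ _ ⟩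
    coefficient p k                                            ∎

  private
    module PR = CommutativeRing polynomialCommutativeRing

  -- The factor x - n that extends (x)ₙ to (x)ₙ₊₁ has this shape; the recurrence for `S₁` is read
  -- off from it.
  coefficient-*-[X+constant] : ∀ p a k →
    coefficient (p P.* (X P.+ constant a)) k ≈ coefficient (X P.* p) k + a * coefficient p k
  coefficient-*-[X+constant] p a k = begin
    coefficient (p P.* (X P.+ constant a)) k
      ≈⟨ trans (PR.*-comm p (X P.+ constant a) k) (PR.distribʳ p X (constant a) k) ⟩
    coefficient (X P.* p P.+ constant a P.* p) k
      ≈⟨ coefficient-+ (X P.* p) (constant a P.* p) k ⟩
    coefficient (X P.* p) k + coefficient (constant a P.* p) k
      ≈⟨ +-congˡ (coefficient-constant-* a p k) ⟩
    coefficient (X P.* p) k + a * coefficient p k ∎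

-- Multiplying an expansion by one factor.

module Expansion {c ℓ} (R : CommutativeRing c ℓ) where
  open CommutativeRing R
  open Solver commutativeSemiring using (solve; _:=_; _:+_; _:*_)
  open Factorials rawRing using (sum≤)
  open ≈-Reasoning setoid

  sum≤-last : ∀ n f → sum≤ (suc n) f ≈ sum≤ n f + f (suc n)
  sum≤-last zero    f = trans (+-congˡ (+-identityʳ _)) (+-congʳ (sym (+-identityʳ _)))
  sum≤-last (suc n) f = trans (+-congˡ (sum≤-last n (f ∘ suc))) (sym (+-assoc _ _ _))

  -- Each `a k * b k * z` splits into a part on `b (suc k)` and a part on `b k`. Regrouped by basis
  -- element, neighbouring parts add up to the new coefficients `a′`.
  expansion-step : ∀ (a a′ b w : ℕ → Carrier) z n →
    (∀ k → b k * z ≈ b (suc k) + w k * b k) →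
    a′ 0 ≈ w 0 * a 0 →
    (∀ k → a′ (suc k) ≈ a k + w (suc k) * a (suc k)) →
    a (suc n) ≈ 0# →
    sum≤ n (λ k → a k * b k) * z ≈ sum≤ (suc n) (λ k → a′ k * b k)
  expansion-step a a′ b w z n b-step a′-0 a′-suc a-vanishes = begin
    sum≤ n (λ k → a k * b k) * z
      ≈⟨ telescope n ⟩
    sum≤ n a′b + a n * b (suc n)
      ≈⟨ +-congˡ (begin
        a n * b (suc n)                                     ≈⟨ +-identityʳ _ ⟨
        a n * b (suc n) + 0#                                ≈⟨ +-congˡ (zeroˡ _) ⟨
        a n * b (suc n) + 0# * b (suc n)                    ≈⟨ distribʳ _ _ _ ⟨
        -- As `a (suc n)` vanishes, the leftover of the telescoping is exactly the new top term.
        (a n + 0#) * b (suc n)                              ≈⟨ *-congʳ (+-congˡ (trans (*-congˡ a-vanishes) (zeroʳ _))) ⟨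
        (a n + w (suc n) * a (suc n)) * b (suc n)           ≈⟨ *-congʳ (a′-suc n) ⟨
        a′b (suc n)                                         ∎) ⟩
    sum≤ n a′b + a′b (suc n)
      ≈⟨ sum≤-last n a′b ⟨
    sum≤ (suc n) a′b ∎
    where
    ab a′b : ℕ → Carrier
    ab k = a k * b k
    a′b k = a′ k * b k
    -- The last summand is the half of the m-th term that waits to be joined with the next one.
    telescope : ∀ m → sum≤ m ab * z ≈ sum≤ m a′b + a m * b (suc m)
    telescope zero    = begin
      (a 0 * b 0 + 0#) * z                      ≈⟨ *-congʳ (+-identityʳ _) ⟩
      a 0 * b 0 * z                             ≈⟨ *-assoc _ _ _ ⟩
      a 0 * (b 0 * z)                           ≈⟨ *-congˡ (b-step 0) ⟩
      a 0 * (b 1 + w 0 * b 0)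
        ≈⟨ solve 4 (λ a b w b′ → a :* (b′ :+ w :* b) := w :* a :* b :+ a :* b′) refl (a 0) (b 0) (w 0) (b 1) ⟩
      w 0 * a 0 * b 0 + a 0 * b 1               ≈⟨ +-congʳ (*-congʳ a′-0) ⟨
      a′ 0 * b 0 + a 0 * b 1                    ≈⟨ +-congʳ (+-identityʳ _) ⟨
      a′ 0 * b 0 + 0# + a 0 * b 1               ∎
    telescope (suc m) = begin
      sum≤ (suc m) ab * z
        ≈⟨ *-congʳ (sum≤-last m ab) ⟩
      (sum≤ m ab + ab (suc m)) * z
        ≈⟨ distribʳ _ _ _ ⟩
      sum≤ m ab * z + a (suc m) * b (suc m) * z
        ≈⟨ +-cong (telescope m) (trans (*-assoc _ _ _) (*-congˡ (b-step (suc m)))) ⟩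
      (t + a m * b (suc m)) + a (suc m) * (b (suc (suc m)) + w (suc m) * b (suc m))
        ≈⟨ solve 6 (λ t a b a′ b′ w →
             (t :+ a :* b) :+ a′ :* (b′ :+ w :* b) := (t :+ (a :+ w :* a′) :* b) :+ a′ :* b′)
             refl t (a m) (b (suc m)) (a (suc m)) (b (suc (suc m))) (w (suc m)) ⟩
      (t + (a m + w (suc m) * a (suc m)) * b (suc m)) + a (suc m) * b (suc (suc m))
        ≈⟨ +-congʳ (+-congˡ (*-congʳ (a′-suc m))) ⟨
      (t + a′b (suc m)) + a (suc m) * b (suc (suc m))
        ≈⟨ +-congʳ (sum≤-last m a′b) ⟨
      sum≤ (suc m) a′b + a (suc m) * b (suc (suc m)) ∎
      where
      t = sum≤ m a′b

-- Expanding degenerate factorials over a general basis.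

module DegenerateFactorialExpansion {c₁ ℓ₁ c₂ ℓ₂}
    (R : CommutativeRing c₁ ℓ₁) (B : CommutativeRing c₂ ℓ₂)
    (φ : CommutativeRing.Carrier R → CommutativeRing.Carrier B)
    (φ-isRingHomomorphism :
      IsRingHomomorphism (CommutativeRing.rawRing R) (CommutativeRing.rawRing B) φ) where
  private
    module R = CommutativeRing R
    module R× = SemiringMult R.semiring
  open CommutativeRing B
  open IsRingHomomorphism φ-isRingHomomorphism
  open SemiringMult semiring using (×-congʳ) renaming (_×_ to _·_)
  open RawSemiringDefinitions (RawRing.rawSemiring rawRing) using (_^_)
  open Factorials rawRing
  open Solver commutativeSemiring using (solve; _:=_; _:+_; _:*_)
  open ≈-Reasoning setoid

  φ-· : ∀ n a → φ (n R×.× a) ≈ n · φ a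
  φ-· zero    a = 0#-homo
  φ-· (suc n) a = trans (+-homo a (n R×.× a)) (+-congˡ (φ-· n a))

  φ-neg-· : ∀ n a → φ (R.- (n R×.× a)) ≈ - (n · φ a)
  φ-neg-· n a = trans (-‿homo _) (-‿cong (φ-· n a))

  -- Induction on n: the new factor of the degenerate factorial is absorbed by `expansion-step`.
  -- Coefficients and weights stay in `R`, where their recurrences are proved, and reach `B` through
  -- `φ`.
  expansion : ∀ y l (b : ℕ → Carrier) (w s : ℕ → ℕ → R.Carrier) →
    b 0 ≈ 1# →
    (∀ n k → b k * (y + - (n · φ l)) ≈ b (suc k) + φ (w n k) * b k) →
    s 0 0 R.≈ R.1# →
    (∀ n → s (suc n) 0 R.≈ w n 0 R.* s n 0) →
    (∀ n k → s (suc n) (suc k) R.≈ s n k R.+ w n (suc k) R.* s n (suc k)) →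
    (∀ {n k} → n < k → s n k R.≈ R.0#) →
    ∀ n → degenerateFactorial y (φ l) n ≈ sum≤ n (λ k → φ (s n k) * b k)
  expansion y l b w s b-0 b-step s-0-0 s-suc-0 s-suc-suc s-vanishes = go
    where
    go : ∀ n → degenerateFactorial y (φ l) n ≈ sum≤ n (λ k → φ (s n k) * b k)
    go zero    = begin
      1#                       ≈⟨ *-identityˡ 1# ⟨
      1# * 1#                  ≈⟨ *-cong (trans (⟦⟧-cong s-0-0) 1#-homo) b-0 ⟨
      φ (s 0 0) * b 0          ≈⟨ +-identityʳ _ ⟨
      φ (s 0 0) * b 0 + 0#     ∎
    go (suc n) = trans (*-congʳ (go n))
      (Expansion.expansion-step B (φ ∘ s n) (φ ∘ s (suc n)) b (φ ∘ w n) (y + - (n · φ l)) n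
        (b-step n)
        (trans (⟦⟧-cong (s-suc-0 n)) (*-homo _ _))
        (λ k → trans (⟦⟧-cong (s-suc-suc n k)) (trans (+-homo _ _) (+-congˡ (*-homo _ _))))
        (trans (⟦⟧-cong (s-vanishes (n<1+n n))) 0#-homo))

  -- Split x + r - n l as (x - k) + (r + k - n l); the first part extends the falling factorial.
  fallingFactorial-step : ∀ x r l n k →
    fallingFactorial x k * (x + φ r + - (n · φ l)) ≈
    fallingFactorial x (suc k) + φ (r R.+ k R×.× R.1# R.+ R.- (n R×.× l)) * fallingFactorial x k
  fallingFactorial-step x r l n k = begin
    f * (x + ρ + N)
      ≈⟨ *-congˡ (trans (+-congˡ (-‿inverseˡ K)) (+-identityʳ _)) ⟨
    f * (x + ρ + N + (- K + K))
      ≈⟨ solve 6 (λ f x ρ N K′ K →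
           f :* (x :+ ρ :+ N :+ (K′ :+ K)) := f :* (x :+ K′) :+ (ρ :+ K :+ N) :* f)
           refl f x ρ N (- K) K ⟩
    f * (x + - K) + (ρ + K + N) * f
      ≈⟨ +-congˡ (*-congʳ (begin
        φ (r R.+ k R×.× R.1# R.+ R.- (n R×.× l))
          ≈⟨ trans (+-homo _ _) (+-congʳ (+-homo _ _)) ⟩
        ρ + φ (k R×.× R.1#) + φ (R.- (n R×.× l))
          ≈⟨ +-cong (+-congˡ (trans (φ-· k R.1#) (×-congʳ k 1#-homo))) (φ-neg-· n l) ⟩
        ρ + K + N ∎)) ⟨
    f * (x + - K) + φ (r R.+ k R×.× R.1# R.+ R.- (n R×.× l)) * f ∎
    where
    f = fallingFactorial x k
    ρ = φ r
    N = - (n · φ l)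
    K = k · 1#

  power-step : ∀ y l n k →
    y ^ k * (y + - (n · φ l)) ≈ y ^ suc k + φ (R.- (n R×.× l)) * y ^ k
  power-step y l n k = begin
    y ^ k * (y + - (n · φ l))                     ≈⟨ *-comm _ _ ⟩
    (y + - (n · φ l)) * y ^ k                     ≈⟨ distribʳ _ _ _ ⟩
    y ^ suc k + - (n · φ l) * y ^ k               ≈⟨ +-congˡ (*-congʳ (φ-neg-· n l)) ⟨
    y ^ suc k + φ (R.- (n R×.× l)) * y ^ k        ∎

-- Recurrence for the Stirling numbers of the first kind, scaled by powers of l.

module Stirling₁Recurrence {c ℓ} (A : CommutativeℚAlgebra c ℓ) where
  open CommutativeℚAlgebra A
  open RingProperties ring using (-‿distribʳ-*)
  open CommutativeSemigroupProperties *-commutativeSemigroup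
    using (interchange; x∙yz≈y∙xz; x∙yz≈yx∙z)
  open SemiringMult semiring using (×-comm-*; ×-congʳ) renaming (_×_ to _·_)
  open RawSemiringDefinitions rawSemiring using (_^_)
  open Polynomials rawRing
  open Factorials polynomialRing
  open PolynomialRing commutativeRing
  open Stirling A using (S₁)
  open ≈-Reasoning setoid

  private
    module P = CommutativeRing polynomialCommutativeRing
    module φ = DegenerateFactorialExpansion commutativeRing polynomialCommutativeRing
      constant constant-isRingHomomorphism
    module P× = RawSemiringDefinitions (RawRing.rawSemiring polynomialRing)

  S₁-suc : ∀ n k → S₁ (suc n) k ≈
    coefficient (X P.* fallingFactorial X n) k + - (n · 1#) * S₁ n k
  S₁-suc n k = trans
    -- The multiple n of the polynomial 1 is first rewritten as a constant polynomial.
    (P.*-congˡ {f} {X P.+ P.- (n P×.× P.1#)} {X P.+ constant (- (n · 1#))}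
      (P.+-congˡ {X} {P.- (n P×.× P.1#)} {constant (- (n · 1#))}
        (P.sym {constant (- (n · 1#))} {P.- (n P×.× P.1#)} (φ.φ-neg-· n 1#))) k)
    (coefficient-*-[X+constant] f (- (n · 1#)) k)
    where
    f = fallingFactorial X n

  S₁-suc-0 : ∀ n → S₁ (suc n) 0 ≈ - (n · 1#) * S₁ n 0
  S₁-suc-0 n = trans (S₁-suc n 0)
    (trans (+-congʳ (coefficient-X-*-0 (fallingFactorial X n))) (+-identityˡ _))

  S₁-suc-suc : ∀ n k → S₁ (suc n) (suc k) ≈ S₁ n k + - (n · 1#) * S₁ n (suc k)
  S₁-suc-suc n k = trans (S₁-suc n (suc k))
    (+-congʳ (coefficient-X-*-suc (fallingFactorial X n) k))

  S₁-vanishes : ∀ {n k} → n < k → S₁ n k ≈ 0#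
  S₁-vanishes {zero}  {suc k} _         = refl
  S₁-vanishes {suc n} {suc k} (s<s n<k) = begin
    S₁ (suc n) (suc k)                      ≈⟨ S₁-suc-suc n k ⟩
    S₁ n k + - (n · 1#) * S₁ n (suc k)      ≈⟨ +-cong (S₁-vanishes n<k) (*-congˡ (S₁-vanishes (m<n⇒m<1+n n<k))) ⟩
    0# + - (n · 1#) * 0#                    ≈⟨ trans (+-identityˡ _) (zeroʳ _) ⟩
    0#                                      ∎

  -- The coefficient of xᵏ in (x|l)ₙ. For k > n the truncated exponent is 0, which is harmless
  -- because `S₁ n k` is then 0.
  scaledS₁ : Carrier → ℕ → ℕ → Carrier
  scaledS₁ l n k = l ^ (n ∸ k) * S₁ n k

  neg-·-* : ∀ n l → - (n · l) ≈ l * - (n · 1#)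
  neg-·-* n l = trans (-‿cong (sym (trans (×-comm-* n l 1#) (×-congʳ n (*-identityʳ l)))))
    (-‿distribʳ-* l (n · 1#))

  scaledS₁-suc-0 : ∀ l n → scaledS₁ l (suc n) 0 ≈ - (n · l) * scaledS₁ l n 0
  scaledS₁-suc-0 l n = begin
    l * l ^ n * S₁ (suc n) 0               ≈⟨ *-congˡ (S₁-suc-0 n) ⟩
    l * l ^ n * (- (n · 1#) * S₁ n 0)      ≈⟨ interchange l (l ^ n) _ _ ⟩
    l * - (n · 1#) * (l ^ n * S₁ n 0)      ≈⟨ *-congʳ (neg-·-* n l) ⟨
    - (n · l) * (l ^ n * S₁ n 0)           ∎

  -- For k ≥ n the exponents n ∸ k and n ∸ (k + 1) coincide, but then S₁ n (k + 1) = 0.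
  ^-∸-S₁ : ∀ l n k → l ^ (n ∸ k) * S₁ n (suc k) ≈ l * scaledS₁ l n (suc k)
  ^-∸-S₁ l n k with k <? n
  ... | yes k<n = trans (*-congʳ (reflexive (≡.cong (l ^_) (+-∸-assoc 1 k<n)))) (*-assoc _ _ _)
  ... | no  k≮n = begin
    l ^ (n ∸ k) * S₁ n (suc k)              ≈⟨ *-congˡ S₁≈0 ⟩
    l ^ (n ∸ k) * 0#                        ≈⟨ zeroʳ _ ⟩
    0#                                      ≈⟨ zeroʳ l ⟨
    l * 0#                                  ≈⟨ *-congˡ (zeroʳ _) ⟨
    l * (l ^ (n ∸ suc k) * 0#)              ≈⟨ *-congˡ (*-congˡ S₁≈0) ⟨
    l * scaledS₁ l n (suc k)                ∎
    where
    S₁≈0 = S₁-vanishes {n} {suc k} (s≤s (≮⇒≥ k≮n))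

  -- `suc n ∸ suc k` reduces to `n ∸ k`, which suits the first summand; in the second there is one
  -- power of l too many, and it turns the weight -n into -n l.
  scaledS₁-suc-suc : ∀ l n k →
    scaledS₁ l (suc n) (suc k) ≈ scaledS₁ l n k + - (n · l) * scaledS₁ l n (suc k)
  scaledS₁-suc-suc l n k = begin
    l ^ (n ∸ k) * S₁ (suc n) (suc k)
      ≈⟨ *-congˡ (S₁-suc-suc n k) ⟩
    l ^ (n ∸ k) * (S₁ n k + - (n · 1#) * S₁ n (suc k))
      ≈⟨ distribˡ _ _ _ ⟩
    scaledS₁ l n k + l ^ (n ∸ k) * (- (n · 1#) * S₁ n (suc k))
      ≈⟨ +-congˡ (x∙yz≈y∙xz _ _ _) ⟩
    scaledS₁ l n k + - (n · 1#) * (l ^ (n ∸ k) * S₁ n (suc k))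
      ≈⟨ +-congˡ (*-congˡ (^-∸-S₁ l n k)) ⟩
    scaledS₁ l n k + - (n · 1#) * (l * scaledS₁ l n (suc k))
      ≈⟨ +-congˡ (trans (x∙yz≈yx∙z _ _ _) (*-congʳ (sym (neg-·-* n l)))) ⟩
    scaledS₁ l n k + - (n · l) * scaledS₁ l n (suc k) ∎

  scaledS₁-vanishes : ∀ l {n k} → n < k → scaledS₁ l n k ≈ 0#
  scaledS₁-vanishes l n<k = trans (*-congˡ (S₁-vanishes n<k)) (zeroʳ _)

-- The two expansions of the degenerate factorial of x + r.

theorem2p2 : ∀ {c ℓ} (A : CommutativeℚAlgebra c ℓ) →
    let module A = CommutativeℚAlgebra A
        module A′ = RawSemiringDefinitions A.rawSemiring
        open Polynomials A.rawRing
        open RawRing polynomialRing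
        open RawSemiringDefinitions rawSemiring using (_^_)
        open Factorials polynomialRing
        open Stirling A
    in (l : A.Carrier) (r n : ℕ) →
       let x+r = X + constant (r A′.× A.1#) in
       (degenerateFactorial x+r (constant l) n
          ≈ sum≤ n (λ k → constant (S₂ l r n k) * fallingFactorial X k))
       ×
       (sum≤ n (λ k → constant (S₂ l r n k) * fallingFactorial X k)
          ≈ sum≤ n (λ k → constant ((l A′.^ (n ∸ k)) A.* S₁ n k) * (x+r ^ k)))
-- The two sums are compared coefficient by coefficient through the degenerate factorial that both
-- equal.
theorem2p2 A l r n = S₂-expansion , λ k → A.trans (A.sym (S₂-expansion k)) (S₁-expansion k)
  where
  module A = CommutativeℚAlgebra A
  module A′ = RawSemiringDefinitions A.rawSemiring
  open Polynomials A.rawRing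
  open PolynomialRing A.commutativeRing
  open Stirling₂Recurrence A
  open Stirling₁Recurrence A
  open Stirling A
  open DegenerateFactorialExpansion A.commutativeRing polynomialCommutativeRing
    constant constant-isRingHomomorphism
  open CommutativeRing polynomialCommutativeRing using (_+_; rawRing)
  open RawSemiringDefinitions (RawRing.rawSemiring rawRing) using (_^_)
  open Factorials rawRing

  ρ = r A′.× A.1#
  x+r = X + constant ρ

  S₂-expansion = expansion x+r l (fallingFactorial X)
    (λ n k → ρ A.+ k A′.× A.1# A.+ A.- (n A′.× l)) (S₂ l r)
    (λ _ → A.refl) (fallingFactorial-step X ρ l)
    (S₂-0-0 l r) (S₂-suc-0 l r) (S₂-suc-suc l r) (S₂-vanishes l r) n

  S₁-expansion = expansion x+r l (x+r ^_)
    (λ n k → A.- (n A′.× l)) (scaledS₁ l)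
    (λ _ → A.refl) (power-step x+r l)
    -- `scaledS₁ l 0 0` reduces to `1# * 1#` for every l, including 0, by the convention 0⁰ = 1.
    (A.*-identityˡ A.1#) (scaledS₁-suc-0 l) (scaledS₁-suc-suc l) (scaledS₁-vanishes l) n
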